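{- Let $p>3$ be a prime and let $A\subseteq \mathbb{F}_p$ be a subset with $|A|>\frac{2}{7}\,p$. Then $A+A-2A=\mathbb{F}_p$, where $A+A-2A=\{a_1+a_2-2a_3\colon a_1,a_2,a_3\in A\}$.
   Context: $\mathbb{F}_p$ denotes the finite field with $p$ elements. -}

module Defs where

open import Data.Nat using (ℕ; _+_; _*_; _∸_; NonZero)
open import Data.Nat.DivMod using (_mod_)
open import Data.Fin using (Fin; toℕ)

-- The finite field 𝔽_p is modelled by Fin p (residues 0,…,p-1) with
-- arithmetic modulo p.

_+ₚ_ : ∀ {p} .{{_ : NonZero p}} → Fin p → Fin p → Fin p
_+ₚ_ {p} x y = (toℕ x + toℕ y) mod p

-ₚ_ : ∀ {p} .{{_ : NonZero p}} → Fin p → Fin p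
-ₚ_ {p} x = (p ∸ toℕ x) mod p

_-ₚ_ : ∀ {p} .{{_ : NonZero p}} → Fin p → Fin p → Fin p
x -ₚ y = x +ₚ (-ₚ y)

2·ₚ_ : ∀ {p} .{{_ : NonZero p}} → Fin p → Fin p
2·ₚ x = x +ₚ x

{-# OPTIONS --safe #-}
module Submission where

-- Let g = x / 6 in 𝔽_p, which makes sense as p > 3.  A subset of
-- {0, …, 16} without solutions of i + j = 2 l + 6 has weight at most 20 with
-- respect to `weights`, whose total is 70.  Summing the weight of
-- {i : t + i g ∈ A} over all t gives 70 |A| > 20 p, so for some t this set
-- does contain a solution, and then
-- (t + i g) + (t + j g) - 2 (t + l g) = 6 g = x.

open import Defs
open import Data.Bool using (Bool; true; false; T; _∧_; _∨_; if_then_else_)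
open import Data.Bool.Properties using (T-∧; T-∨; T-≡)
open import Data.Fin using (Fin; zero; suc; toℕ)
open import Data.Fin.Properties using (toℕ-fromℕ<; toℕ-injective; toℕ<n)
open import Data.Fin.Subset using (Subset; _∈_; ∣_∣)
open import Data.List using (List; []; _∷_; applyUpTo)
open import Data.List.Relation.Unary.All using (All; []; _∷_; lookupAny)
open import Data.List.Relation.Unary.Any using (Any; any?)
open import Data.Nat using (ℕ; zero; suc; _+_; _*_; _∸_; _≤_; _<_; _≤ᵇ_; _≟_; _<?_; NonZero)
open import Data.Nat.Coprimality using (prime⇒coprime; coprime-Bézout)
open import Data.Nat.DivMod using (_%_; _mod_; m%n<n; m%n%n≡m%n; m<n⇒m%n≡m; [m+n]%n≡m%n; [m+kn]%n≡m%n; %-distribˡ-+; %-distribˡ-*)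
open import Data.Nat.GCD using (module Bézout)
open import Data.Nat.ListAction using (sum)
open import Data.Nat.Primality using (Prime)
open import Data.Nat.Properties
open import Data.Nat.Solver using (module +-*-Solver)
open import Data.Product using (∃-syntax; _×_; _,_)
open import Data.Sum using (_⊎_; inj₁; inj₂; [_,_]′)
open import Data.Vec using ([]; _∷_; lookup)
open import Data.Vec.Properties using (lookup⇒[]=)
open import Function using (_∘_; Equivalence)
open import Relation.Binary.PropositionalEquality using (_≡_; refl; sym; trans; cong; cong₂; subst; module ≡-Reasoning)
open import Relation.Nullary using (Dec; yes; no; contradiction)
open import Relation.Nullary.Decidable using (⌊_⌋; toWitness)

open +-*-Solver using (solve; _:=_; _:+_; _:*_; con)

-- Finite sums, periodic shifts and averaging.

sumUpTo : (ℕ → ℕ) → ℕ → ℕ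
sumUpTo f n = sum (applyUpTo f n)

-- `applyUpTo` unfolds from the front; the shift argument also has to split off the last term.
sumUpTo-suc : ∀ f n → sumUpTo f (suc n) ≡ sumUpTo f n + f n
sumUpTo-suc f zero    = +-identityʳ (f 0)
sumUpTo-suc f (suc n) = trans (cong (f 0 +_) (sumUpTo-suc (f ∘ suc) n))
  (sym (+-assoc (f 0) _ _))

sumUpTo-+ : ∀ f g n → sumUpTo (λ t → f t + g t) n ≡ sumUpTo f n + sumUpTo g n
sumUpTo-+ f g zero    = refl
sumUpTo-+ f g (suc n) = trans
  (cong ((f 0 + g 0) +_) (sumUpTo-+ (f ∘ suc) (g ∘ suc) n))
  (solve 4 (λ a b c d → (a :+ b) :+ (c :+ d) := (a :+ c) :+ (b :+ d)) refl
    (f 0) (g 0) (sumUpTo (f ∘ suc) n) (sumUpTo (g ∘ suc) n))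

sumUpTo-* : ∀ c f n → sumUpTo (λ t → c * f t) n ≡ c * sumUpTo f n
sumUpTo-* c f zero    = sym (*-zeroʳ c)
sumUpTo-* c f (suc n) = trans (cong (c * f 0 +_) (sumUpTo-* c (f ∘ suc) n))
  (sym (*-distribˡ-+ c (f 0) _))

sumUpTo-0 : ∀ n → sumUpTo (λ _ → 0) n ≡ 0
sumUpTo-0 zero    = refl
sumUpTo-0 (suc n) = sumUpTo-0 n

sumUpTo-cong : ∀ {f g} → (∀ t → f t ≡ g t) → ∀ n → sumUpTo f n ≡ sumUpTo g n
sumUpTo-cong f≗g zero    = refl
sumUpTo-cong f≗g (suc n) = cong₂ _+_ (f≗g 0) (sumUpTo-cong (f≗g ∘ suc) n)

-- Induction on `c`: the windows starting at `c` and at `suc c` differ only in the end terms `f c`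
-- and `f (p + c)`, which agree by periodicity.
sumUpTo-shift : ∀ f p → (∀ t → f (t + p) ≡ f t) →
                ∀ c → sumUpTo (λ t → f (t + c)) p ≡ sumUpTo f p
sumUpTo-shift f p per zero    = sumUpTo-cong (λ t → cong f (+-identityʳ t)) p
sumUpTo-shift f p per (suc c) = trans
  (+-cancelˡ-≡ (f c) _ _ (begin
    f c + sumUpTo (λ t → f (t + suc c)) p
      ≡⟨ cong (f c +_) (sumUpTo-cong (λ t → cong f (+-suc t c)) p) ⟩
    sumUpTo (λ t → f (t + c)) (suc p)
      ≡⟨ sumUpTo-suc (λ t → f (t + c)) p ⟩
    sumUpTo (λ t → f (t + c)) p + f (p + c)
      ≡⟨ cong (sumUpTo (λ t → f (t + c)) p +_) (trans (cong f (+-comm p c)) (per c)) ⟩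
    sumUpTo (λ t → f (t + c)) p + f c
      ≡⟨ +-comm _ (f c) ⟩
    f c + sumUpTo (λ t → f (t + c)) p ∎))
  (sumUpTo-shift f p per c)
  where open ≡-Reasoning

-- If the first term is at most `b`, removing it on one side and one `b` on the other keeps the
-- inequality strict; for `n = 0` it would read 0 < 0.
pigeonhole-sum : ∀ b f n → n * b < sumUpTo f n → ∃[ t ] b < f t
pigeonhole-sum b f (suc n) lt with b <? f 0
... | yes b<f0 = 0 , b<f0
... | no  b≮f0 with pigeonhole-sum b (f ∘ suc) n
                     (+-cancelˡ-< b _ _ (<-≤-trans lt (+-monoˡ-≤ _ (≮⇒≥ b≮f0))))
...   | t , b<ft = suc t , b<ft

-- Weighted counting on indices.

χ : Bool → ℕ
χ b = if b then 1 else 0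

-- The index of the list's head is explicit, so a tail of the weights is still read against the
-- original `f`, as in the search below.
weightFrom : ℕ → List ℕ → (ℕ → Bool) → ℕ
weightFrom i []       f = 0
weightFrom i (w ∷ ws) f = w * χ (f i) + weightFrom (suc i) ws f

-- The two summations are interchanged, and every index then sees the same total `s`.
sumUpTo-weightFrom : ∀ (h : ℕ → ℕ → Bool) n s →
  (∀ i → sumUpTo (λ t → χ (h t i)) n ≡ s) →
  ∀ i ws → sumUpTo (λ t → weightFrom i ws (h t)) n ≡ sum ws * s
sumUpTo-weightFrom h n s hyp i []       = sumUpTo-0 n
sumUpTo-weightFrom h n s hyp i (w ∷ ws) = begin
  sumUpTo (λ t → w * χ (h t i) + weightFrom (suc i) ws (h t)) n
    ≡⟨ sumUpTo-+ (λ t → w * χ (h t i)) (λ t → weightFrom (suc i) ws (h t)) n ⟩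
  sumUpTo (λ t → w * χ (h t i)) n + sumUpTo (λ t → weightFrom (suc i) ws (h t)) n
    ≡⟨ cong₂ _+_ (trans (sumUpTo-* w (λ t → χ (h t i)) n) (cong (w *_) (hyp i)))
                 (sumUpTo-weightFrom h n s hyp (suc i) ws) ⟩
  w * s + sum ws * s
    ≡⟨ *-distribʳ-+ s w (sum ws) ⟨
  (w + sum ws) * s ∎
  where open ≡-Reasoning

-- Exhaustive search over solution-free sets.

HasSolution : List ℕ → Set
HasSolution S = Any (λ a → Any (λ b → Any (λ c → a + b ≡ 2 * c + 6) S) S) S

hasSolution? : ∀ S → Dec (HasSolution S)
hasSolution? S = any? (λ a → any? (λ b → any? (λ c → a + b ≟ 2 * c + 6) S) S) S

Solution : (ℕ → Bool) → Set
Solution f = ∃[ i ] ∃[ j ] ∃[ l ] (T (f i) × T (f j) × T (f l) × i + j ≡ 2 * l + 6)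

solution : ∀ {f S} → All (T ∘ f) S → HasSolution S → Solution f
solution S⊆f a∈S with lookupAny S⊆f a∈S
... | fa , b∈S with lookupAny S⊆f b∈S
...   | fb , c∈S with lookupAny S⊆f c∈S
...     | fc , eq = _ , _ , _ , fa , fb , fc , eq

-- Depth-first search through the solution-free extensions by elements ≥ i of
-- a set S of weight s.
boundedBy : ℕ → List ℕ → ℕ → List ℕ → ℕ → Bool
boundedBy b []       i S s = s ≤ᵇ b
boundedBy b (w ∷ ws) i S s =
  boundedBy b ws (suc i) S s ∧
  (⌊ hasSolution? (i ∷ S) ⌋ ∨ boundedBy b ws (suc i) (i ∷ S) (s + w))

-- `f` selects one path through the search. Along it `S` stays inside `f`, so a solution that prunes
-- the branch is a solution in `f`; otherwise the path ends at a leaf, where the accumulated weight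
-- is compared with `b`.
boundedBy-sound : ∀ b ws i S s (f : ℕ → Bool) → T (boundedBy b ws i S s) →
  All (T ∘ f) S → s + weightFrom i ws f ≤ b ⊎ Solution f
boundedBy-sound b [] i S s f ok S⊆f =
  inj₁ (subst (_≤ b) (sym (+-identityʳ s)) (≤ᵇ⇒≤ s b ok))
boundedBy-sound b (w ∷ ws) i S s f ok S⊆f
  with f i in fi | Equivalence.to (T-∧ {boundedBy b ws (suc i) S s}) ok
... | false | skip , _ rewrite *-zeroʳ w = boundedBy-sound b ws (suc i) S s f skip S⊆f
... | true  | _ , take
  rewrite *-identityʳ w | sym (+-assoc s w (weightFrom (suc i) ws f))
  = [ inj₂ ∘ solution iS⊆f ∘ toWitness
    , (λ ok′ → boundedBy-sound b ws (suc i) (i ∷ S) (s + w) f ok′ iS⊆f)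
    ]′ (Equivalence.to T-∨ take)
  where
  iS⊆f : All (T ∘ f) (i ∷ S)
  iS⊆f = Equivalence.from T-≡ fi ∷ S⊆f

-- An optimal solution of the linear program maximising the total weight
-- subject to solution-free subsets of {0, …, 16} having weight at most 20.
weights : List ℕ
weights = 1 ∷ 2 ∷ 3 ∷ 4 ∷ 5 ∷ 6 ∷ 6 ∷ 7 ∷ 6 ∷ 6 ∷ 6 ∷ 5 ∷ 4 ∷ 4 ∷ 2 ∷ 2 ∷ 1 ∷ []

-- Checked by evaluating the search, which cuts a branch once its set contains a solution instead of
-- visiting all 2^17 subsets.
weights-bounded : boundedBy 20 weights 0 [] 0 ≡ true
weights-bounded = refl

heavy⇒solution : ∀ f → 20 < weightFrom 0 weights f → Solution f
heavy⇒solution f heavy =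
  [ (λ light → contradiction light (<⇒≱ heavy)) , (λ sol → sol) ]′
  (boundedBy-sound 20 weights 0 [] 0 f (Equivalence.from T-≡ weights-bounded) [])

-- Congruences and division modulo p.

%-cong-+ : ∀ {a b c d} p .{{_ : NonZero p}} →
           a % p ≡ b % p → c % p ≡ d % p → (a + c) % p ≡ (b + d) % p
%-cong-+ {a} {b} {c} {d} p a≡b c≡d = begin
  (a + c) % p          ≡⟨ %-distribˡ-+ a c p ⟩
  (a % p + c % p) % p  ≡⟨ cong₂ (λ u v → (u + v) % p) a≡b c≡d ⟩
  (b % p + d % p) % p  ≡⟨ %-distribˡ-+ b d p ⟨
  (b + d) % p          ∎
  where open ≡-Reasoning

%-cong-*ˡ : ∀ n {a b} p .{{_ : NonZero p}} → a % p ≡ b % p → (n * a) % p ≡ (n * b) % p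
%-cong-*ˡ n {a} {b} p a≡b = begin
  (n * a) % p              ≡⟨ %-distribˡ-* n a p ⟩
  ((n % p) * (a % p)) % p  ≡⟨ cong (λ u → ((n % p) * u) % p) a≡b ⟩
  ((n % p) * (b % p)) % p  ≡⟨ %-distribˡ-* n b p ⟨
  (n * b) % p              ∎
  where open ≡-Reasoning

-- A Bézout identity for the coprime pair `p`, `n` provides an inverse of `n`. Over ℕ it comes in
-- two forms, according to the sign of the coefficient of `n`.
divide-mod : ∀ {p n} .{{_ : NonZero p}} .{{_ : NonZero n}} → Prime p → n < p →
             ∀ x → ∃[ g ] (n * g) % p ≡ x % p
divide-mod {p} {n} pr n<p x with coprime-Bézout (prime⇒coprime pr n<p)
... | Bézout.-+ u v eq = v * x , (begin
  (n * (v * x)) % p      ≡⟨ cong (_% p) (solve 3 (λ n v x → n :* (v :* x) := (v :* n) :* x) refl n v x) ⟩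
  ((v * n) * x) % p      ≡⟨ cong (λ z → (z * x) % p) eq ⟨
  ((1 + u * p) * x) % p  ≡⟨ cong (_% p) (solve 3 (λ u p x → (con 1 :+ u :* p) :* x := x :+ (u :* x) :* p) refl u p x) ⟩
  (x + (u * x) * p) % p  ≡⟨ [m+kn]%n≡m%n x (u * x) p ⟩
  x % p                  ∎)
  where open ≡-Reasoning
-- Here v n ≡ -1, so v² n is an inverse of n.
... | Bézout.+- u v eq = v * v * n * x , (begin
  (n * (v * v * n * x)) % p
    -- Adding the multiple `x * u * p`, rewritten as `x * (1 + v * n)`, avoids subtraction: the sum
    -- becomes `x` plus a multiple of `1 + v * n`, hence of `p`.
    ≡⟨ [m+kn]%n≡m%n _ (x * u) p ⟨
  (n * (v * v * n * x) + (x * u) * p) % p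
    ≡⟨ cong (λ z → (n * (v * v * n * x) + z) % p) (trans (*-assoc x u p) (cong (x *_) (sym eq))) ⟩
  (n * (v * v * n * x) + x * (1 + v * n)) % p
    ≡⟨ cong (_% p) (solve 3 (λ n v x → n :* (v :* v :* n :* x) :+ x :* (con 1 :+ v :* n)
         := x :+ (v :* n :* x) :* (con 1 :+ v :* n)) refl n v x) ⟩
  (x + (v * n * x) * (1 + v * n)) % p
    ≡⟨ cong (λ z → (x + z) % p) (trans (cong (v * n * x *_) eq) (sym (*-assoc (v * n * x) u p))) ⟩
  (x + (v * n * x * u) * p) % p
    ≡⟨ [m+kn]%n≡m%n x (v * n * x * u) p ⟩
  x % p ∎)
  where open ≡-Reasoning

-- Division by 3 and then by 2, both below `p`; 6 itself exceeds `p` when `p = 5`.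
divide-mod-6 : ∀ {p} .{{_ : NonZero p}} → Prime p → 3 < p →
               ∀ x → ∃[ g ] (6 * g) % p ≡ x % p
divide-mod-6 {p} pr 3<p x with divide-mod {n = 3} pr 3<p x
... | h , 3h≡x with divide-mod {n = 2} pr (<-trans ≤-refl 3<p) h
...   | g , 2g≡h = g , (begin
  (6 * g) % p        ≡⟨ cong (_% p) (*-assoc 3 2 g) ⟩
  (3 * (2 * g)) % p  ≡⟨ %-cong-*ˡ 3 p 2g≡h ⟩
  (3 * h) % p        ≡⟨ 3h≡x ⟩
  x % p              ∎)
  where open ≡-Reasoning

-- Passing between congruences in ℕ and equations in `Fin p`.

toℕ-mod : ∀ m p .{{_ : NonZero p}} → toℕ (m mod p) ≡ m % p
toℕ-mod m p = toℕ-fromℕ< (m%n<n m p)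

toℕ-% : ∀ {p} .{{_ : NonZero p}} (i : Fin p) → toℕ i % p ≡ toℕ i
toℕ-% i = m<n⇒m%n≡m (toℕ<n i)

mod-cong : ∀ {a b} p .{{_ : NonZero p}} → a % p ≡ b % p → a mod p ≡ b mod p
mod-cong {a} {b} p eq = toℕ-injective (trans (toℕ-mod a p) (trans eq (sym (toℕ-mod b p))))

toℕ-+ₚ-mod : ∀ a b p .{{_ : NonZero p}} → toℕ ((a mod p) +ₚ (b mod p)) ≡ (a + b) % p
toℕ-+ₚ-mod a b p = begin
  toℕ ((a mod p) +ₚ (b mod p))           ≡⟨ toℕ-mod _ p ⟩
  (toℕ (a mod p) + toℕ (b mod p)) % p    ≡⟨ cong₂ (λ u v → (u + v) % p) (toℕ-mod a p) (toℕ-mod b p) ⟩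
  (a % p + b % p) % p                    ≡⟨ %-distribˡ-+ a b p ⟨
  (a + b) % p                            ∎
  where open ≡-Reasoning

≡-+ₚ-2·ₚ : ∀ {p} .{{_ : NonZero p}} (x : Fin p) a b c →
           (a + b) % p ≡ (toℕ x + (c + c)) % p →
           x ≡ ((a mod p) +ₚ (b mod p)) -ₚ (2·ₚ (c mod p))
≡-+ₚ-2·ₚ {p} x a b c eq = toℕ-injective (sym (begin
  toℕ (s -ₚ d)                                  ≡⟨ toℕ-mod _ p ⟩
  (toℕ s + toℕ (-ₚ d)) % p                      ≡⟨ %-cong-+ p s≡x+d (trans (cong (_% p) (toℕ-mod _ p)) (m%n%n≡m%n _ p)) ⟩
  ((toℕ x + toℕ d) + (p ∸ toℕ d)) % p           ≡⟨ cong (_% p) (+-assoc (toℕ x) (toℕ d) _) ⟩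
  -- The truncated subtraction is exact because `toℕ d < p`.
  (toℕ x + (toℕ d + (p ∸ toℕ d))) % p           ≡⟨ cong (λ z → (toℕ x + z) % p) (m+[n∸m]≡n (<⇒≤ (toℕ<n d))) ⟩
  (toℕ x + p) % p                               ≡⟨ [m+n]%n≡m%n (toℕ x) p ⟩
  toℕ x % p                                     ≡⟨ toℕ-% x ⟩
  toℕ x                                         ∎))
  where
  open ≡-Reasoning
  s d : Fin p
  s = (a mod p) +ₚ (b mod p)
  d = 2·ₚ (c mod p)
  s≡x+d : toℕ s % p ≡ (toℕ x + toℕ d) % p
  s≡x+d = begin
    toℕ s % p                  ≡⟨ cong (_% p) (toℕ-+ₚ-mod a b p) ⟩
    (a + b) % p % p            ≡⟨ m%n%n≡m%n (a + b) p ⟩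
    (a + b) % p                ≡⟨ eq ⟩
    (toℕ x + (c + c)) % p      ≡⟨ %-cong-+ p refl (sym (trans (cong (_% p) (toℕ-+ₚ-mod c c p)) (m%n%n≡m%n (c + c) p))) ⟩
    (toℕ x + toℕ d) % p        ∎

-- Averaging over progressions and conclusion.

-- Any `f` agreeing with the indicator of `A` is allowed, so that the induction can pass to
-- `f ∘ suc`.
∣∣-sumUpTo : ∀ {n} (A : Subset n) (f : ℕ → ℕ) →
             (∀ i → f (toℕ i) ≡ χ (lookup A i)) → sumUpTo f n ≡ ∣ A ∣
∣∣-sumUpTo []          f hyp = refl
∣∣-sumUpTo (true ∷ A)  f hyp = cong₂ _+_ (hyp zero) (∣∣-sumUpTo A (f ∘ suc) (hyp ∘ suc))
∣∣-sumUpTo (false ∷ A) f hyp = cong₂ _+_ (hyp zero) (∣∣-sumUpTo A (f ∘ suc) (hyp ∘ suc))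

-- For fixed `i`, `t + i * g` runs over all residues as `t` does. Terms of one progression may
-- coincide, for instance if `p < 17`; weights belong to indices, so the count is unaffected.
∃-heavy-progression : ∀ p .{{_ : NonZero p}} (A : Subset p) → 2 * p < 7 * ∣ A ∣ → ∀ g →
  ∃[ t ] 20 < weightFrom 0 weights (λ i → lookup A ((t + i * g) mod p))
∃-heavy-progression p A 2p<7∣A∣ g =
  pigeonhole-sum 20 (λ t → weightFrom 0 weights (h t)) p heavy-average
  where
  indicator : ℕ → Bool
  indicator m = lookup A (m mod p)

  h : ℕ → ℕ → Bool
  h t i = indicator (t + i * g)

  sum-indicator : ∀ i → sumUpTo (λ t → χ (h t i)) p ≡ ∣ A ∣
  sum-indicator i = trans
    (sumUpTo-shift (χ ∘ indicator) p
      (λ t → cong (χ ∘ lookup A) (mod-cong p ([m+n]%n≡m%n t p))) (i * g))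
    (∣∣-sumUpTo A (χ ∘ indicator)
      (λ j → cong (χ ∘ lookup A) (toℕ-injective (trans (toℕ-mod (toℕ j) p) (toℕ-% j)))))

  heavy-average : p * 20 < sumUpTo (λ t → weightFrom 0 weights (h t)) p
  heavy-average = begin-strict
    p * 20              ≡⟨ *-comm p 20 ⟩
    20 * p              ≡⟨ *-assoc 10 2 p ⟩
    10 * (2 * p)        <⟨ *-monoʳ-< 10 2p<7∣A∣ ⟩
    -- The total `sum weights` evaluates to 70.
    10 * (7 * ∣ A ∣)    ≡⟨ *-assoc 10 7 ∣ A ∣ ⟨
    sum weights * ∣ A ∣ ≡⟨ sumUpTo-weightFrom h p ∣ A ∣ sum-indicator 0 weights ⟨
    sumUpTo (λ t → weightFrom 0 weights (h t)) p ∎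
    where open ≤-Reasoning

theorem1p1 : (p : ℕ) .{{_ : NonZero p}} → Prime p → 3 < p →
    (A : Subset p) → 2 * p < 7 * ∣ A ∣ →
    (x : Fin p) → ∃[ a₁ ] ∃[ a₂ ] ∃[ a₃ ]
    (a₁ ∈ A × a₂ ∈ A × a₃ ∈ A × x ≡ (a₁ +ₚ a₂) -ₚ (2·ₚ a₃))
theorem1p1 p pr 3<p A 2p<7∣A∣ x =
  let g , 6g≡x = divide-mod-6 pr 3<p (toℕ x)
      t , heavy = ∃-heavy-progression p A 2p<7∣A∣ g
  in fromSolution t g 6g≡x (heavy⇒solution _ heavy)
  where
  member : ∀ {a} → T (lookup A a) → a ∈ A
  member a∈ = lookup⇒[]= _ A (Equivalence.to T-≡ a∈)

  -- Both sides contain `t` twice, and `i + j` exceeds `2 * l` by 6, so the remaining difference is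
  -- `6 * g`, congruent to `x`.
  progression-+ : ∀ t g i j l → i + j ≡ 2 * l + 6 → (6 * g) % p ≡ toℕ x % p →
    (t + i * g + (t + j * g)) % p ≡ (toℕ x + (t + l * g + (t + l * g))) % p
  progression-+ t g i j l i+j≡2l+6 6g≡x = begin
    (t + i * g + (t + j * g)) % p
      ≡⟨ cong (_% p) (solve 4 (λ t i j g → t :+ i :* g :+ (t :+ j :* g)
           := t :+ t :+ (i :+ j) :* g) refl t i j g) ⟩
    (t + t + (i + j) * g) % p
      ≡⟨ cong (λ z → (t + t + z * g) % p) i+j≡2l+6 ⟩
    (t + t + (2 * l + 6) * g) % p
      ≡⟨ cong (_% p) (solve 3 (λ t l g → t :+ t :+ (con 2 :* l :+ con 6) :* g
           := con 6 :* g :+ (t :+ l :* g :+ (t :+ l :* g))) refl t l g) ⟩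
    (6 * g + (t + l * g + (t + l * g))) % p
      ≡⟨ %-cong-+ p 6g≡x refl ⟩
    (toℕ x + (t + l * g + (t + l * g))) % p ∎
    where open ≡-Reasoning

  fromSolution : ∀ t g → (6 * g) % p ≡ toℕ x % p →
    Solution (λ i → lookup A ((t + i * g) mod p)) →
    ∃[ a₁ ] ∃[ a₂ ] ∃[ a₃ ] (a₁ ∈ A × a₂ ∈ A × a₃ ∈ A × x ≡ (a₁ +ₚ a₂) -ₚ (2·ₚ a₃))
  fromSolution t g 6g≡x (i , j , l , i∈ , j∈ , l∈ , i+j≡2l+6) =
    (t + i * g) mod p , (t + j * g) mod p , (t + l * g) mod p ,
    member i∈ , member j∈ , member l∈ ,
    ≡-+ₚ-2·ₚ x (t + i * g) (t + j * g) (t + l * g)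
      (progression-+ t g i j l i+j≡2l+6 6g≡x)
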